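{- For every $n\ge1$ there is a bijection $\phi^{(D)}_C:\mathcal{CUD}^{(D)}_n\to\mathcal{T}^*_n$ which, for each $1\le k\le n$, restricts to a bijection from $\mathcal{CUD}^{(D)}_{n,k}$ onto $\mathcal{T}^*_{n,k}$.
   Context: A signed permutation of $[n]$ is a bijection $\sigma$ of $[\pm n]$ with $\sigma(-i)=-\sigma(i)$; $\bar a=-a$; cycles on $[\pm n]$ are written $(c_1,\dots,c_r)$ with $\sigma(c_j)=c_{j+1}$, $\sigma(c_r)=c_1$; if $C$ is a cycle so is $-C$. $\mathcal{CUD}^{(D)}_n$: signed permutations with exactly one cycle $C=-C$, this cycle being $(k,\bar k)$ for some $k\in[n]$, all other cycles in pairs $\{C,-C\}$ with $C\ne -C$, such that, choosing from each pair the cycle in which the entry of smallest absolute value is positive, written starting with that entry, and ordering them as $(a_{1,1},\dots)\cdots(a_{m-1,1},\dots)$ with $a_{1,1}<\dots<a_{m-1,1}$, we have $a_{m-1,1}<k$ and each cycle satisfies $|a_{i,1}|<|a_{i,2}|>|a_{i,3}|<\cdots$. $\mathcal{CUD}^{(D)}_{n,k}$: those whose special cycle is $(k,\bar k)$. $\mathcal{T}_n$ is the set of complete increasing binary trees with $n$ labelled nodes: plane rooted trees in which every node is either a leaf or has exactly two ordered children (left, right), exactly $n$ nodes carry labels, bijectively from $[n]$, every non-leaf node is labelled (leaves may be labelled or unlabelled; unlabelled leaves are called empty), and labels increase along every path from the root. The rightmost path is $(v_1,\dots,v_d)$, $v_1$ the root, $v_{i+1}$ the right child of $v_i$, $v_d$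 a leaf. $\mathcal{T}^\circ_n$ ($\mathcal{T}^*_n$): trees whose rightmost leaf $v_d$ is empty (labelled). The rightmost label is the label of $v_{d-1}$ for $\tau\in\mathcal{T}^\circ_n$ and of $v_d$ for $\tau\in\mathcal{T}^*_n$. $\mathcal{T}^\circ_{n,k}$, $\mathcal{T}^*_{n,k}$: those with rightmost label $k$. -}

module Defs where

open import Data.Bool using (Bool; true; false; not)
open import Data.Fin using (Fin; _<_; _>_)
open import Data.List using (List; []; _∷_; _++_; map; allFin)
open import Data.List.Membership.Propositional using (_∈_; _∉_)
open import Data.List.Relation.Unary.All using (All)
open import Data.List.Relation.Unary.Unique.Propositional using (Unique)
open import Data.List.Relation.Binary.Permutation.Propositional using (_↭_)
open import Data.Maybe using (Maybe; just; nothing)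
open import Data.Product using (Σ; ∃; ∃-syntax; _×_; _,_; proj₁; proj₂)
open import Data.Unit using (⊤)
open import Data.Nat using (ℕ)
open import Level using (0ℓ)
open import Function.Definitions using (Bijective)
open import Relation.Binary.Bundles using (Setoid)
open import Relation.Binary.PropositionalEquality using (_≡_; _→-setoid_)
import Relation.Binary.PropositionalEquality as ≡
import Relation.Binary.Construct.On as On

-- Signed entries.  The set [±n] is encoded as  Bool × Fin n :
-- (false , i) is the positive entry  i+1,  (true , i) is the negative
-- entry  -(i+1).  (Fin n = {0,…,n-1} encodes [n] = {1,…,n}, order
-- preserving.)

SE : (n : ℕ) → Set
SE n = Bool × Fin n

neg : ∀ {n} → SE n → SE n
neg (b , i) = (not b , i)

pos : ∀ {n} → Fin n → SE n
pos i = (false , i)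

∣_∣ₛ : ∀ {n} → SE n → Fin n
∣ (_ , i) ∣ₛ = i

IsPositive : ∀ {n} → SE n → Set
IsPositive (b , _) = b ≡ false

IsSignedPerm : ∀ {n} → (SE n → SE n) → Set
IsSignedPerm σ = (∀ x → σ (neg x) ≡ neg (σ x)) × Bijective _≡_ _≡_ σ

SignedPerm : (n : ℕ) → Set
SignedPerm n = Σ (SE n → SE n) IsSignedPerm

Chain : ∀ {n} → (SE n → SE n) → SE n → List (SE n) → Set
Chain σ x []       = ⊤
Chain σ x (y ∷ ys) = σ x ≡ y × Chain σ y ys

lastOf : ∀ {A : Set} → A → List A → A
lastOf c []       = c
lastOf c (y ∷ ys) = lastOf y ys

IsCycle : ∀ {n} → (SE n → SE n) → SE n → List (SE n) → Set
IsCycle σ c rest = Chain σ c rest × σ (lastOf c rest) ≡ c × Unique (c ∷ rest)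

data Dir : Set where
  up down : Dir

Alt : ∀ {n} → Dir → Fin n → List (Fin n) → Set
Alt d    a []       = ⊤
Alt up   a (b ∷ bs) = a < b × Alt down b bs
Alt down a (b ∷ bs) = a > b × Alt up b bs

IsCUD : ∀ {n} → (SE n → SE n) → Fin n → Set
IsCUD {n} σ k =
  -- (k , k̄) is a cycle
  σ (pos k) ≡ neg (pos k)
  -- it is the only cycle C with C = -C
  × (∀ (c : SE n) rest → IsCycle σ c rest → neg c ∈ (c ∷ rest) → ∣ c ∣ₛ ≡ k)
  × (∀ (c : SE n) rest → IsCycle σ c rest → neg c ∉ (c ∷ rest)
       → IsPositive c → All (λ y → ∣ c ∣ₛ < ∣ y ∣ₛ) rest
       → (∣ c ∣ₛ < k) × Alt up ∣ c ∣ₛ (map ∣_∣ₛ rest))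

CUD : (n : ℕ) → Set
CUD n = Σ (SignedPerm n) (λ σ → ∃[ k ] IsCUD (proj₁ σ) k)

CUD-setoid : (n : ℕ) → Setoid 0ℓ 0ℓ
CUD-setoid n = On.setoid {B = CUD n} (SE n →-setoid SE n) (λ x → proj₁ (proj₁ x))

data Tree (n : ℕ) : Set where
  leaf : Maybe (Fin n) → Tree n
  node : Fin n → Tree n → Tree n → Tree n

labels : ∀ {n} → Tree n → List (Fin n)
labels (leaf nothing)  = []
labels (leaf (just a)) = a ∷ []
labels (node a l r)    = a ∷ labels l ++ labels r

Increasing : ∀ {n} → Tree n → Set
Increasing (leaf _)     = ⊤
Increasing (node a l r) =
  All (a <_) (labels l) × All (a <_) (labels r) × Increasing l × Increasing r

rightmostLeaf : ∀ {n} → Tree n → Maybe (Fin n)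
rightmostLeaf (leaf m)     = m
rightmostLeaf (node _ _ r) = rightmostLeaf r

IsT : ∀ {n} → Tree n → Set
IsT {n} t = labels t ↭ allFin n × Increasing t

IsTstar : ∀ {n} → Tree n → Set
IsTstar t = IsT t × ∃[ k ] rightmostLeaf t ≡ just k

Tstar : (n : ℕ) → Set
Tstar n = Σ (Tree n) IsTstar

Tstar-setoid : (n : ℕ) → Setoid 0ℓ 0ℓ
Tstar-setoid n = On.setoid {B = Tstar n} (≡.setoid (Tree n)) proj₁

{-# OPTIONS --safe #-}
-- The root path v₁ < … < v_d of a tree in T* lists the smallest labels v₁, …, v_{d-1}
-- of the ordinary cycles, followed by the label v_d = k of the special cycle.  It thus
-- suffices to match the left subtree of v_i with the rest of the cycle starting at v_i,
-- that is, increasing trees with signed alternating words on the same labels.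
-- Inductively, the two subtrees of a root a are two words (u , v).  On the other hand, a
-- word splits at its smallest letter ±a into (p , q), where alternation forces the lengths
-- into certain parity classes.  The two kinds of pairs are matched by concatenating u and v
-- in one of the two orders, as chosen by the sign of a; if both lengths are even,
-- then one letter is first moved from one word to the other.
module Submission where

open import Defs
open import Data.Bool using (Bool; true; false; not; _xor_)
import Data.Bool.Properties as Boolₚ
open import Data.Bool.Properties using (not-involutive; xor-comm)
open import Data.Empty using (⊥-elim)
open import Data.Fin using (Fin; zero; suc; _<_; combine)
import Data.Fin.Properties as Finₚ
open import Data.Fin.Properties using (<-cmp; <-trans; <-irrefl; <-asym; injective⇒≤; combine-injective)
open import Data.List using (List; []; _∷_; [_]; _++_; map; length; lookup; filter; reverse; _ʳ++_; allFin)
open import Data.List.Properties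
  using (∷-injective; ∷-injectiveʳ; map-++; length-++; length-filter; reverse-injective; reverse-involutive)
import Data.List.Membership.DecPropositional as DecMembership
open import Data.List.Membership.Propositional using (_∈_; _∉_)
open import Data.List.Membership.Propositional.Properties
  using (∈-++⁺ˡ; ∈-++⁺ʳ; ∈-++⁻; ∈-map⁺; ∈-map⁻; ∈-lookup; ∈-filter⁺; ∈-filter⁻; ∈-allFin)
open import Data.List.Membership.Propositional.Properties.WithK using (unique∧set⇒bag)
open import Data.List.Relation.Binary.BagAndSetEquality using (∼bag⇒↭)
open import Data.List.Relation.Binary.Permutation.Propositional
  using (_↭_; ↭-refl; ↭-sym; ↭-trans; prep; ↭-reflexive; ↭⇒↭ₛ)
open import Data.List.Relation.Binary.Permutation.Propositional.Properties
  using (shift; ++-comm; ↭-length; All-resp-↭; ∈-resp-↭; drop-∷; ↭-singleton-inv; ↭-reverse)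
  renaming (map⁺ to ↭-map⁺; ++⁺ to ↭-++⁺)
import Data.List.Relation.Binary.Permutation.Setoid.Properties as ↭ₛ
open import Data.List.Relation.Unary.All as All using (All; []; _∷_)
import Data.List.Relation.Unary.All.Properties as Allₚ
open import Data.List.Relation.Unary.AllPairs as AllPairs using (AllPairs; []; _∷_)
import Data.List.Relation.Unary.AllPairs.Properties as AllPairsₚ
open import Data.List.Relation.Unary.Any using (here; there; tail)
open import Data.List.Relation.Unary.Unique.Propositional using (Unique)
import Data.List.Relation.Unary.Unique.Propositional.Properties as Uniqueₚ
open import Data.Maybe using (just; nothing)
open import Data.Maybe.Properties using (just-injective)
open import Data.Nat as ℕ using (ℕ; _≤_; zero; suc; s≤s)
import Data.Nat.Properties as ℕₚ
open import Data.Product using (Σ; ∃; ∃-syntax; ∃₂; _×_; _,_; proj₁; proj₂)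
open import Data.Product.Properties using (≡-dec)
open import Data.Sum using (_⊎_; inj₁; inj₂; map₂)
open import Data.Unit using (tt)
open import Function using (_∘_; id; case_of_)
open import Function.Bundles using (Bijection; _⇔_; mk⇔)
import Function.Construct.Composition as Composition
import Function.Construct.Identity as Identity
open import Function.Definitions using (Bijective)
open import Relation.Binary using (tri<; tri≈; tri>)
open import Relation.Binary.PropositionalEquality using (_≡_; _≢_; refl; sym; trans; cong; subst; setoid)
open import Relation.Nullary using (¬_; ¬?; Dec; yes; no; contradiction)

private variable
  n : ℕ

-- Absolute values and lists without repetition.

abs : List (SE n) → List (Fin n)
abs = map ∣_∣ₛ

_≺_ : SE n → SE n → Set
x ≺ y = ∣ x ∣ₛ < ∣ y ∣ₛ

_≺*_ : Fin n → List (SE n) → Set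
a ≺* w = All (λ x → a < ∣ x ∣ₛ) w

Unique-resp-↭ : ∀ {A : Set} {xs ys : List A} → xs ↭ ys → Unique xs → Unique ys
Unique-resp-↭ {A} p = ↭ₛ.Unique-resp-↭ (setoid A) (↭⇒↭ₛ p)

++-unique⁻ : ∀ {A : Set} (xs {ys} : List A) → Unique (xs ++ ys) →
             Unique xs × Unique ys × (∀ {x} → x ∈ xs → x ∉ ys)
++-unique⁻ []       u = [] , u , λ ()
++-unique⁻ (x ∷ xs) (x∉ ∷ u) with ++-unique⁻ xs u
... | ux , uy , dj = Allₚ.++⁻ˡ xs x∉ ∷ ux , uy ,
  λ { (here refl) y → All.lookup (Allₚ.++⁻ʳ xs x∉) y refl ; (there m) → dj m }

-- Alternating signed words.

-- A snake x₁, …, x_r with |x₁| > |x₂| < |x₃| > … is stored in reverse, so that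
-- the parity of its length decides whether the first entry of the list is a
-- peak (odd length) or a valley (even length).
mutual
  data OddW {n} : List (SE n) → Set where
    single : ∀ {x} → OddW [ x ]
    peak   : ∀ {x y ys} → y ≺ x → EvenW (y ∷ ys) → OddW (x ∷ y ∷ ys)

  data EvenW {n} : List (SE n) → Set where
    []     : EvenW []
    valley : ∀ {x y ys} → x ≺ y → OddW (y ∷ ys) → EvenW (x ∷ y ∷ ys)

Word : List (SE n) → Set
Word w = OddW w ⊎ EvenW w

odd-tail : ∀ {x : SE n} {w} → OddW (x ∷ w) → EvenW w
odd-tail single     = []
odd-tail (peak _ e) = e

even-tail : ∀ {x : SE n} {w} → EvenW (x ∷ w) → OddW w
even-tail (valley _ o) = o

¬odd×even : {w : List (SE n)} → OddW w → ¬ EvenW w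
¬odd×even (peak y<x _) (valley x<y _) = <-asym x<y y<x

-- Matching the two kinds of pairs of words.

-- Mix u v p s q: the pair of words (u , v) corresponds to the pair of words
-- (p , q) together with a sign s, where p ++ (s , a) ∷ q is again a word when
-- a is smaller than all other labels.  This requires q to be odd, or p and q to
-- be empty.  For two even words, the larger of their two first entries is a
-- valley that can be prepended to the other word, which makes both of them odd;
-- it is recovered as the smaller of the two first entries of the result.
data Mix {n} : List (SE n) → List (SE n) → List (SE n) → _ → List (SE n) → Set where
  odd       : ∀ {u v} → OddW u → Word v → Mix u v v false u
  even-odd  : ∀ {u v} → EvenW u → OddW v → Mix u v u true v
  empty     : Mix [] [] [] true []
  moveˡ     : ∀ {x u v} → EvenW (x ∷ u) → OddW (x ∷ v) → Mix (x ∷ u) v (x ∷ v) true u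
  moveʳ     : ∀ {y u v} → EvenW (y ∷ v) → OddW (y ∷ u) → Mix u (y ∷ v) v true (y ∷ u)

mix-words : ∀ {u v p s q} → Mix {n} u v p s q → Word u × Word v
mix-words (odd o w)       = inj₁ o , w
mix-words (even-odd e o)  = inj₂ e , inj₁ o
mix-words empty           = inj₂ [] , inj₂ []
mix-words (moveˡ e o)     = inj₂ e , inj₂ (odd-tail o)
mix-words (moveʳ e o)     = inj₂ (odd-tail o) , inj₂ e

-- Disjointness of the labels makes the comparison of the two first entries strict when both words
-- are even and nonempty.
mix-total : ∀ {u v} → Word {n} u → Word v → (∀ {i} → i ∈ abs u → i ∉ abs v) →
            ∃[ p ] ∃[ s ] ∃[ q ] Mix u v p s q
mix-total (inj₁ o) w dj = _ , _ , _ , odd o w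
mix-total (inj₂ e) (inj₁ o) dj = _ , _ , _ , even-odd e o
mix-total (inj₂ []) (inj₂ []) dj = _ , _ , _ , empty
mix-total (inj₂ []) (inj₂ e@(valley _ _)) dj = _ , _ , _ , moveʳ e single
mix-total (inj₂ e@(valley _ _)) (inj₂ []) dj = _ , _ , _ , moveˡ e single
mix-total {u = x ∷ _} {y ∷ _} (inj₂ e@(valley _ _)) (inj₂ f@(valley _ _)) dj with <-cmp ∣ x ∣ₛ ∣ y ∣ₛ
... | tri< x<y _ _ = _ , _ , _ , moveʳ f (peak x<y e)
... | tri≈ _ eq _  = contradiction (here eq) (dj (here refl))
... | tri> _ _ y<x = _ , _ , _ , moveˡ e (peak y<x f)

-- Parities and emptiness of `u` and `v` select the rule, except that two nonempty even words leave
-- both moves open; there the `peak` condition on the first entries decides.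
mix-functional : ∀ {u v p p' s s' q q'} → Mix {n} u v p s q → Mix u v p' s' q' →
                 p ≡ p' × s ≡ s' × q ≡ q'
mix-functional (odd _ _) (odd _ _) = refl , refl , refl
mix-functional (odd o _) (even-odd e _) = contradiction e (¬odd×even o)
mix-functional (odd o _) (moveˡ e _) = contradiction e (¬odd×even o)
mix-functional (odd o _) (moveʳ _ o') = contradiction (odd-tail o') (¬odd×even o)
mix-functional (even-odd e _) (odd o _) = contradiction e (¬odd×even o)
mix-functional (even-odd _ _) (even-odd _ _) = refl , refl , refl
mix-functional (even-odd _ o) (moveˡ _ o') = contradiction (odd-tail o') (¬odd×even o)
mix-functional (even-odd _ o) (moveʳ e _) = contradiction e (¬odd×even o)
mix-functional empty empty = refl , refl , refl
mix-functional (moveˡ e _) (odd o _) = contradiction e (¬odd×even o)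
mix-functional (moveˡ _ o') (even-odd _ o) = contradiction (odd-tail o') (¬odd×even o)
mix-functional (moveˡ _ _) (moveˡ _ _) = refl , refl , refl
mix-functional (moveˡ _ (peak y<x _)) (moveʳ _ (peak x<y _)) = contradiction x<y (<-asym y<x)
mix-functional (moveʳ _ o') (odd o _) = contradiction (odd-tail o') (¬odd×even o)
mix-functional (moveʳ e _) (even-odd _ o) = contradiction e (¬odd×even o)
mix-functional (moveʳ _ (peak x<y _)) (moveˡ _ (peak y<x _)) = contradiction x<y (<-asym y<x)
mix-functional (moveʳ _ _) (moveʳ _ _) = refl , refl , refl

-- The sign isolates `odd`, and the parity of `p` separates the moves from `even-odd` and `empty`.
-- In both moves `p` and `q` are odd, and the moves differ in which first entry is smaller.
mix-injective : ∀ {u u' v v' p s q} → Mix {n} u v p s q → Mix u' v' p s q → u ≡ u' × v ≡ v'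
mix-injective (odd _ _) (odd _ _) = refl , refl
mix-injective (even-odd _ _) (even-odd _ _) = refl , refl
mix-injective (even-odd e _) (moveˡ _ o) = contradiction e (¬odd×even o)
mix-injective (even-odd e _) (moveʳ e' _) = contradiction e (¬odd×even (even-tail e'))
mix-injective empty empty = refl , refl
mix-injective (moveˡ _ o) (even-odd e _) = contradiction e (¬odd×even o)
mix-injective (moveˡ _ _) (moveˡ _ _) = refl , refl
mix-injective (moveˡ (valley x<y _) _) (moveʳ (valley y<x _) _) = contradiction x<y (<-asym y<x)
mix-injective (moveʳ e' _) (even-odd e _) = contradiction e (¬odd×even (even-tail e'))
mix-injective (moveʳ (valley y<x _) _) (moveˡ (valley x<y _) _) = contradiction x<y (<-asym y<x)
mix-injective (moveʳ _ _) (moveʳ _ _) = refl , refl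

mix-↭ : ∀ {u v p s q} → Mix {n} u v p s q → p ++ q ↭ u ++ v
mix-↭ (odd {u} {v} _ _)  = ++-comm v u
mix-↭ (even-odd _ _)     = ↭-refl
mix-↭ empty              = ↭-refl
mix-↭ (moveˡ {u = u} {v} _ _)  = prep _ (++-comm v u)
mix-↭ (moveʳ {y} {u} {v} _ _)  = ↭-trans (++-comm v (y ∷ u)) (↭-sym (shift y u v))

-- Words cut at their smallest letter, and the words of increasing trees.

mutual
  -- Positions are counted from the end of the list, where every nonempty word has a peak. So a
  -- nonempty `p` ends in a peak, `q` of odd length starts with one, and `x` fits in front of `q` as
  -- a valley.
  odd-join : ∀ {p q} {x : SE n} → ∣ x ∣ₛ ≺* p → ∣ x ∣ₛ ≺* q → OddW p → OddW q → OddW (p ++ x ∷ q)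
  odd-join (x<y ∷ []) (x<z ∷ _) single o@single = peak x<y (valley x<z o)
  odd-join (x<y ∷ []) (x<z ∷ _) single o@(peak _ _) = peak x<y (valley x<z o)
  odd-join (_ ∷ xp) xq (peak y<x e) o = peak y<x (even-join xp xq e o)

  even-join : ∀ {p q} {x : SE n} → ∣ x ∣ₛ ≺* p → ∣ x ∣ₛ ≺* q → EvenW p → OddW q → EvenW (p ++ x ∷ q)
  even-join [] (x<z ∷ _) [] o@single = valley x<z o
  even-join [] (x<z ∷ _) [] o@(peak _ _) = valley x<z o
  even-join (_ ∷ xp) xq (valley x<y o') o = valley x<y (odd-join xp xq o' o)

mutual
  -- The smallest letter cannot be a peak beside another letter. Hence it is alone or a valley, and
  -- in a valley the part `q` after it has odd length.
  odd-split : ∀ p {q} {x : SE n} → ∣ x ∣ₛ ≺* p → ∣ x ∣ₛ ≺* q → OddW (p ++ x ∷ q) →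
              (p ≡ [] × q ≡ []) ⊎ (OddW p × OddW q)
  odd-split [] _ _ single = inj₁ (refl , refl)
  odd-split [] _ (x<y ∷ _) (peak y<x _) = contradiction y<x (<-asym x<y)
  odd-split (y ∷ []) (_ ∷ xp) xq (peak y<x e) with even-split [] xp xq e
  ... | _ , oq = inj₂ (single , oq)
  odd-split (y ∷ p@(_ ∷ _)) (_ ∷ xp) xq (peak y<x e) with even-split p xp xq e
  ... | ep , oq = inj₂ (peak y<x ep , oq)

  even-split : ∀ p {q} {x : SE n} → ∣ x ∣ₛ ≺* p → ∣ x ∣ₛ ≺* q → EvenW (p ++ x ∷ q) →
               EvenW p × OddW q
  even-split [] _ _ (valley _ o) = [] , o
  even-split (y ∷ []) (x<y ∷ _) _ (valley y<x _) = contradiction y<x (<-asym x<y)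
  even-split (y ∷ p@(_ ∷ _)) (_ ∷ xp) xq (valley y<z o) with odd-split p xp xq o
  ... | inj₂ (op , oq) = valley y<z op , oq

mix-word : ∀ {u v p s q a} → Mix {n} u v p s q → a ≺* p → a ≺* q → Word (p ++ (s , a) ∷ q)
mix-word (odd o (inj₁ o')) ap aq = inj₁ (odd-join ap aq o' o)
mix-word (odd o (inj₂ e)) ap aq = inj₂ (even-join ap aq e o)
mix-word (even-odd e o) ap aq = inj₂ (even-join ap aq e o)
mix-word empty ap aq = inj₁ single
mix-word (moveˡ e o) ap aq = inj₁ (odd-join ap aq o (even-tail e))
mix-word (moveʳ e o) ap aq = inj₁ (odd-join ap aq (even-tail e) o)

-- The first alternative is the one-letter word `pos a`, reserved for a labelled leaf. With negative
-- sign the same letter comes from two empty words.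
mix-surjective : ∀ p s {q a} → Word {n} (p ++ (s , a) ∷ q) → a ≺* p → a ≺* q →
                 (∀ {i} → i ∈ abs p → i ∉ abs q) →
                 (p ≡ [] × s ≡ false × q ≡ []) ⊎ ∃₂ λ u v → Mix u v p s q
mix-surjective p s (inj₁ o) ap aq dj with odd-split p ap aq o
mix-surjective p false (inj₁ o) ap aq dj | inj₁ (refl , refl) = inj₁ (refl , refl , refl)
mix-surjective p true  (inj₁ o) ap aq dj | inj₁ (refl , refl) = inj₂ (_ , _ , empty)
mix-surjective p false (inj₁ o) ap aq dj | inj₂ (op , oq) = inj₂ (_ , _ , odd oq (inj₁ op))
-- The smaller first entry is the one that was moved, so it returns as a valley in front of the
-- other word.
mix-surjective (x ∷ p) true {y ∷ q} (inj₁ o) ap aq dj | inj₂ (op , oq) with <-cmp ∣ x ∣ₛ ∣ y ∣ₛ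
... | tri< x<y _ _ = inj₂ (_ , _ , moveˡ (valley x<y oq) op)
... | tri≈ _ eq _  = contradiction (here eq) (dj (here refl))
... | tri> _ _ y<x = inj₂ (_ , _ , moveʳ (valley y<x op) oq)
mix-surjective p s (inj₂ e) ap aq dj with even-split p ap aq e
mix-surjective p false (inj₂ e) ap aq dj | ep , oq = inj₂ (_ , _ , odd oq (inj₂ ep))
mix-surjective p true  (inj₂ e) ap aq dj | ep , oq = inj₂ (_ , _ , even-odd ep oq)

-- The graph of the map from increasing trees to words. The bounds on `p` and `q` make the root
-- recoverable as the smallest letter.
data WordOf {n} : Tree n → List (SE n) → Set where
  nil  : WordOf (leaf nothing) []
  one  : ∀ {a} → WordOf (leaf (just a)) [ pos a ]
  node : ∀ {a l r u v p s q} → WordOf l u → WordOf r v → Mix u v p s q → a ≺* p → a ≺* q →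
         WordOf (node a l r) (p ++ (s , a) ∷ q)

wordOf-word : ∀ {t w} → WordOf {n} t w → Word w
wordOf-word nil = inj₂ []
wordOf-word one = inj₁ single
wordOf-word (node _ _ m ap aq) = mix-word m ap aq

abs-mix : ∀ {u v p s q} → Mix {n} u v p s q → abs (p ++ q) ↭ abs u ++ abs v
abs-mix {u = u} {v} m = ↭-trans (↭-map⁺ ∣_∣ₛ (mix-↭ m)) (↭-reflexive (map-++ ∣_∣ₛ u v))

abs-wordOf : ∀ {t w} → WordOf {n} t w → abs w ↭ labels t
abs-wordOf nil = ↭-refl
abs-wordOf one = ↭-refl
abs-wordOf (node {p = p} {s} {q} l r m _ _) =
  ↭-trans (↭-map⁺ ∣_∣ₛ (shift (s , _) p q))
          (prep _ (↭-trans (abs-mix m) (↭-++⁺ (abs-wordOf l) (abs-wordOf r))))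

wordOf-increasing : ∀ {t w} → WordOf {n} t w → Increasing t
wordOf-increasing nil = tt
wordOf-increasing one = tt
wordOf-increasing {t = node a l r} (node {p = p} wl wr m ap aq)
  with Allₚ.++⁻ (labels l) (All-resp-↭ (↭-trans (abs-mix m) (↭-++⁺ (abs-wordOf wl) (abs-wordOf wr)))
                            (Allₚ.map⁺ (Allₚ.++⁺ ap aq)))
... | al , ar = al , ar , wordOf-increasing wl , wordOf-increasing wr

wordOf-total : (t : Tree n) → Increasing t → Unique (labels t) → ∃ (WordOf t)
wordOf-total (leaf nothing) _ _ = _ , nil
wordOf-total (leaf (just _)) _ _ = _ , one
wordOf-total (node a l r) (al , ar , il , ir) (_ ∷ ulr)
  with ul , ur , dj ← ++-unique⁻ (labels l) ulr
  with u , wl ← wordOf-total l il ul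
  with v , wr ← wordOf-total r ir ur
  with p , s , q , m ← mix-total (wordOf-word wl) (wordOf-word wr)
         (λ i j → dj (∈-resp-↭ (abs-wordOf wl) i) (∈-resp-↭ (abs-wordOf wr) j))
  with ap , aq ← Allₚ.++⁻ p (Allₚ.map⁻ (All-resp-↭
         (↭-sym (↭-trans (abs-mix m) (↭-++⁺ (abs-wordOf wl) (abs-wordOf wr)))) (Allₚ.++⁺ al ar)))
  = _ , node wl wr m ap aq

wordOf-functional : ∀ {t w w'} → WordOf {n} t w → WordOf t w' → w ≡ w'
wordOf-functional nil nil = refl
wordOf-functional one one = refl
wordOf-functional (node l r m _ _) (node l' r' m' _ _)
  with refl ← wordOf-functional l l' | refl ← wordOf-functional r r'
  with refl , refl , refl ← mix-functional m m' = refl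

-- If the cuts were at different places, each of `a` and `a'` would lie among the letters above the
-- other.
min-split-unique : ∀ p p' {q q' s s'} {a a' : Fin n} → a ≺* p → a ≺* q → a' ≺* p' → a' ≺* q' →
                   p ++ (s , a) ∷ q ≡ p' ++ (s' , a') ∷ q' → p ≡ p' × s ≡ s' × a ≡ a' × q ≡ q'
min-split-unique [] [] _ _ _ _ refl = refl , refl , refl , refl
min-split-unique [] (_ ∷ p') _ aq (a'<a ∷ _) _ refl =
  contradiction (All.lookup aq (∈-++⁺ʳ p' (here refl))) (<-asym a'<a)
min-split-unique (_ ∷ p) [] (a<a' ∷ _) _ _ aq' refl =
  contradiction (All.lookup aq' (∈-++⁺ʳ p (here refl))) (<-asym a<a')
min-split-unique (_ ∷ p) (_ ∷ p') (_ ∷ ap) aq (_ ∷ ap') aq' eq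
  with refl , eq' ← ∷-injective eq
  with refl , refl , refl , refl ← min-split-unique p p' ap aq ap' aq' eq' = refl , refl , refl , refl

-- A node with a one-letter word carries the negative sign, because `odd` needs a nonempty `u`; so
-- `pos a` comes from a leaf alone. For two nodes, the cut at the smallest letter is unique and
-- `mix-injective` applies.
wordOf-injective : ∀ {t t' w w'} → WordOf {n} t w → WordOf t' w' → w ≡ w' → t ≡ t'
wordOf-injective nil nil _ = refl
wordOf-injective nil (node {p = []} _ _ _ _ _) ()
wordOf-injective nil (node {p = _ ∷ _} _ _ _ _ _) ()
wordOf-injective one one refl = refl
wordOf-injective one (node {p = []} _ _ (odd () _) _ _) refl
wordOf-injective one (node {p = _ ∷ []} _ _ _ _ _) ()
wordOf-injective one (node {p = _ ∷ _ ∷ _} _ _ _ _ _) ()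
wordOf-injective (node {p = []} _ _ _ _ _) nil ()
wordOf-injective (node {p = _ ∷ _} _ _ _ _ _) nil ()
wordOf-injective (node {p = []} _ _ (odd () _) _ _) one refl
wordOf-injective (node {p = _ ∷ []} _ _ _ _ _) one ()
wordOf-injective (node {p = _ ∷ _ ∷ _} _ _ _ _ _) one ()
wordOf-injective (node {p = p} l r m ap aq) (node {p = p'} l' r' m' ap' aq') eq
  with refl , refl , refl , refl ← min-split-unique p p' ap aq ap' aq' eq
  with refl , refl ← mix-injective m m'
  with refl ← wordOf-injective l l' refl | refl ← wordOf-injective r r' refl = refl

min-split : ∀ x (w : List (SE n)) → Unique (abs (x ∷ w)) →
            ∃[ p ] ∃[ s ] ∃[ a ] ∃[ q ] x ∷ w ≡ p ++ (s , a) ∷ q × a ≺* p × a ≺* q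
min-split (s , a) [] _ = [] , s , a , [] , refl , [] , []
min-split x@(s , b) (y ∷ w) ((b≢ ∷ b∉) ∷ u) with min-split y w u
... | p , t , a , q , eq , ap , aq with <-cmp a b
... | tri< a<b _ _ = x ∷ p , t , a , q , cong (x ∷_) eq , a<b ∷ ap , aq
... | tri≈ _ refl _ = contradiction refl
        (All.lookup (b≢ ∷ b∉) (∈-map⁺ ∣_∣ₛ (subst ((t , a) ∈_) (sym eq) (∈-++⁺ʳ p (here refl)))))
... | tri> _ _ b<a = [] , s , b , y ∷ w , refl , [] ,
        subst (b ≺*_) (sym eq) (Allₚ.++⁺ (All.map (<-trans b<a) ap) (b<a ∷ All.map (<-trans b<a) aq))

-- A letter may have been moved, so `u` and `v` need not be contiguous parts of the given word. The
-- recursion therefore runs on a bound for the length: together they have one letter fewer.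
wordOf-surjective : ∀ m {w} → length w ≤ m → Word {n} w → Unique (abs w) → ∃[ t ] WordOf t w
wordOf-surjective m {[]} _ _ _ = _ , nil
wordOf-surjective (suc m) {x ∷ w} (s≤s |w|≤m) wd uw
  with p , s , a , q , eq , ap , aq ← min-split x w uw
  with _ ∷ upq ← Unique-resp-↭ (↭-map⁺ ∣_∣ₛ (↭-trans (↭-reflexive eq) (shift (s , a) p q))) uw
  with _ , _ , dj ← ++-unique⁻ (abs p) (subst Unique (map-++ ∣_∣ₛ p q) upq)
  with mix-surjective p s (subst Word eq wd) ap aq dj
... | inj₁ (refl , refl , refl) = _ , subst (WordOf _) (sym eq) one
... | inj₂ (u , v , mx)
  with eu , ev ← mix-words mx
  with uu , uv , _ ← ++-unique⁻ (abs u) (Unique-resp-↭ (abs-mix mx) upq)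
  with |u|+|v|≤m ← subst (_≤ m) (trans (ℕₚ.suc-injective (↭-length (↭-trans (↭-reflexive eq) (shift (s , a) p q))))
                           (trans (↭-length (mix-↭ mx)) (length-++ u))) |w|≤m
  with l , wl ← wordOf-surjective m (ℕₚ.m+n≤o⇒m≤o (length u) |u|+|v|≤m) eu uu
  with r , wr ← wordOf-surjective m (ℕₚ.m+n≤o⇒n≤o (length u) |u|+|v|≤m) ev uv
  = node a l r , subst (WordOf _) (sym eq) (node wl wr mx ap aq)

-- Words and the condition `Alt`.

mutual
  -- `acc` holds the entries already reversed. The last entry of the list is a peak and comes first
  -- after the reversal, so it can follow the ascent from `a`.
  odd⇒alt : ∀ {x : SE n} {xs a} acc → a ≺* (x ∷ xs) → OddW (x ∷ xs) → Alt down ∣ x ∣ₛ (abs acc) →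
            Alt up a (abs (xs ʳ++ (x ∷ acc)))
  odd⇒alt acc (a<x ∷ []) single alt = a<x , alt
  odd⇒alt acc (_ ∷ aw) (peak y<x e) alt = even⇒alt (_ ∷ acc) aw e (y<x , alt)

  even⇒alt : ∀ {x : SE n} {xs a} acc → a ≺* (x ∷ xs) → EvenW (x ∷ xs) → Alt up ∣ x ∣ₛ (abs acc) →
             Alt up a (abs (xs ʳ++ (x ∷ acc)))
  even⇒alt acc (_ ∷ aw) (valley x<y o) alt = odd⇒alt (_ ∷ acc) aw o (x<y , alt)

word⇒alt : ∀ {w : List (SE n)} {a} → a ≺* w → Word w → Alt up a (abs (reverse w))
word⇒alt aw (inj₁ o@single) = odd⇒alt [] aw o tt
word⇒alt aw (inj₁ o@(peak _ _)) = odd⇒alt [] aw o tt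
word⇒alt aw (inj₂ []) = tt
word⇒alt aw (inj₂ e@(valley _ _)) = even⇒alt [] aw e tt

mutual
  alt⇒word-down : ∀ {x : SE n} {acc} ys → OddW (x ∷ acc) → Alt down ∣ x ∣ₛ (abs ys) →
                  Word (ys ʳ++ (x ∷ acc))
  alt⇒word-down [] o _ = inj₁ o
  alt⇒word-down (y ∷ ys) o (y<x , alt) = alt⇒word-up ys (valley y<x o) alt

  alt⇒word-up : ∀ {x : SE n} {acc} ys → EvenW (x ∷ acc) → Alt up ∣ x ∣ₛ (abs ys) →
                Word (ys ʳ++ (x ∷ acc))
  alt⇒word-up [] e _ = inj₂ e
  alt⇒word-up (y ∷ ys) e (x<y , alt) = alt⇒word-down ys (peak x<y e) alt

alt⇒word : ∀ {a : Fin n} w → Alt up a (abs w) → Word (reverse w)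
alt⇒word [] _ = inj₂ []
alt⇒word (x ∷ w) (_ , alt) = alt⇒word-down w single alt

abs-reverse : (w : List (SE n)) → abs (reverse w) ↭ abs w
abs-reverse w = ↭-map⁺ ∣_∣ₛ (↭-reverse w)

-- Signed entries and the cycles of maps on them.

_≟ₛ_ : (x y : SE n) → Dec (x ≡ y)
_≟ₛ_ = ≡-dec Boolₚ._≟_ Finₚ._≟_

neg-involutive : (x : SE n) → neg (neg x) ≡ x
neg-involutive (b , i) = cong (_, i) (not-involutive b)

neg≢ : (x : SE n) → neg x ≢ x
neg≢ (false , _) ()
neg≢ (true , _) ()

same-abs : (x y : SE n) → ∣ x ∣ₛ ≡ ∣ y ∣ₛ → x ≡ y ⊎ neg x ≡ y
same-abs (false , i) (false , .i) refl = inj₁ refl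
same-abs (false , i) (true , .i)  refl = inj₂ refl
same-abs (true , i)  (false , .i) refl = inj₂ refl
same-abs (true , i)  (true , .i)  refl = inj₁ refl

∈-abs⁻ : ∀ (x : SE n) C → ∣ x ∣ₛ ∈ abs C → x ∈ C ⊎ neg x ∈ C
∈-abs⁻ x C m with y , y∈C , eq ← ∈-map⁻ ∣_∣ₛ m with same-abs x y eq
... | inj₁ refl = inj₁ y∈C
... | inj₂ refl = inj₂ y∈C

unique-abs⇒neg∉ : ∀ {C : List (SE n)} {x} → Unique (abs C) → x ∈ C → neg x ∉ C
unique-abs⇒neg∉ {C = _ ∷ _} (x∉ ∷ u) (here refl) (here eq) = neg≢ _ eq
unique-abs⇒neg∉ {C = _ ∷ _} (x∉ ∷ u) (here refl) (there m) = All.lookup x∉ (∈-map⁺ ∣_∣ₛ m) refl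
unique-abs⇒neg∉ {C = _ ∷ _} (x∉ ∷ u) (there m) (here refl) = All.lookup x∉ (∈-map⁺ ∣_∣ₛ m) refl
unique-abs⇒neg∉ {C = _ ∷ _} (x∉ ∷ u) (there m) (there m')  = unique-abs⇒neg∉ u m m'

neg∉⇒unique-abs : (C : List (SE n)) → Unique C → (∀ {x} → x ∈ C → neg x ∉ C) → Unique (abs C)
neg∉⇒unique-abs [] _ _ = []
neg∉⇒unique-abs (x ∷ C) (x∉ ∷ u) no-neg =
  Allₚ.map⁺ (All.tabulate λ {y} m eq → case same-abs x y eq of λ
    { (inj₁ refl) → All.lookup x∉ m refl
    ; (inj₂ refl) → no-neg (here refl) (there m) })
  ∷ neg∉⇒unique-abs C u (λ i j → no-neg (there i) (there j))

last∈ : ∀ {A : Set} (x : A) ys → lastOf x ys ∈ x ∷ ys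
last∈ x [] = here refl
last∈ x (y ∷ ys) = there (last∈ y ys)

Closed : (SE n → SE n) → (SE n → Set) → Set
Closed σ P = ∀ x → P x → P (σ x)

module _ {σ : SE n → SE n} where

  chain-forward : ∀ {P x} ys → Closed σ P → Chain σ x ys → P x → ∀ {z} → z ∈ x ∷ ys → P z
  chain-forward ys cl ch px (here refl) = px
  chain-forward (y ∷ ys) cl (refl , ch) px (there m) = chain-forward ys cl ch (cl _ px) m

  chain-to-last : ∀ {P x} ys → Closed σ P → Chain σ x ys → ∀ {z} → z ∈ x ∷ ys → P z → P (lastOf x ys)
  chain-to-last ys cl ch (here refl) pz = chain-forward ys cl ch pz (last∈ _ ys)
  chain-to-last (y ∷ ys) cl (_ , ch) (there m) pz = chain-to-last ys cl ch m pz

  chain-next : ∀ {x} ys → Chain σ x ys → ∀ {z} → z ∈ x ∷ ys → z ≡ lastOf x ys ⊎ σ z ∈ ys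
  chain-next [] _ (here refl) = inj₁ refl
  chain-next (y ∷ ys) (eq , _) (here refl) = inj₂ (here eq)
  chain-next (y ∷ ys) (_ , ch) (there m) = map₂ there (chain-next ys ch m)

  chain-previous : ∀ {x} ys → Chain σ x ys → ∀ {z} → z ∈ ys → ∃[ y ] y ∈ x ∷ ys × σ y ≡ z
  chain-previous (y ∷ ys) (eq , _) (here refl) = _ , here refl , eq
  chain-previous (y ∷ ys) (_ , ch) (there m) with z , z∈ , eq ← chain-previous ys ch m = z , there z∈ , eq

  -- Both chains follow `σ`, so they could differ only in length; then the shorter would be followed
  -- by `c`, which the longer would have to contain.
  chain-unique : ∀ {c x} r r' → Chain σ x r → Chain σ x r' → σ (lastOf x r) ≡ c → σ (lastOf x r') ≡ c →
                 c ∉ r → c ∉ r' → r ≡ r'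
  chain-unique [] [] _ _ _ _ _ _ = refl
  chain-unique [] (y ∷ _) _ (eq' , _) eq _ _ c∉ = contradiction (here (trans (sym eq) eq')) c∉
  chain-unique (y ∷ _) [] (eq' , _) _ _ eq c∉ _ = contradiction (here (trans (sym eq) eq')) c∉
  chain-unique (y ∷ r) (y' ∷ r') (refl , ch) (refl , ch') e e' c∉ c∉' =
    cong (y ∷_) (chain-unique r r' ch ch' e e' (c∉ ∘ there) (c∉' ∘ there))

  module _ {c : SE n} {rest : List (SE n)} (cyc : IsCycle σ c rest) where

    private
      chain = proj₁ cyc
      close = proj₁ (proj₂ cyc)
      uniq  = proj₂ (proj₂ cyc)

    cycle-to-start : ∀ {P} → Closed σ P → ∀ {z} → z ∈ c ∷ rest → P z → P c
    cycle-to-start {P} cl m pz = subst P close (cl _ (chain-to-last rest cl chain m pz))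

    cycle-closed : Closed σ (_∈ c ∷ rest)
    cycle-closed z m with chain-next rest chain m
    ... | inj₁ refl = here close
    ... | inj₂ m'   = there m'

    cycle-previous : ∀ {z} → z ∈ c ∷ rest → ∃[ y ] y ∈ c ∷ rest × σ y ≡ z
    cycle-previous (here refl) = _ , last∈ c rest , close
    cycle-previous (there m)   = chain-previous rest chain m

    cycle-unique : ∀ {rest'} → IsCycle σ c rest' → rest ≡ rest'
    cycle-unique (chain' , close' , uniq') = chain-unique rest _ chain chain' close close' (c∉ uniq) (c∉ uniq')
      where
      c∉ : ∀ {xs} → Unique (c ∷ xs) → c ∉ xs
      c∉ (h ∷ _) m = All.lookup h m refl

chain-agree : ∀ {σ σ' : SE n → SE n} {x} ys → (∀ {z} → z ∈ x ∷ ys → σ z ≡ σ' z) → Chain σ x ys → Chain σ' x ys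
chain-agree [] ag _ = tt
chain-agree (y ∷ ys) ag (eq , ch) = trans (sym (ag (here refl))) eq , chain-agree ys (ag ∘ there) ch

cycle-agree : ∀ {σ σ' : SE n → SE n} {c rest} → (∀ {z} → z ∈ c ∷ rest → σ z ≡ σ' z) →
              IsCycle σ c rest → IsCycle σ' c rest
cycle-agree {rest = rest} ag (ch , cl , u) =
  chain-agree rest ag ch , trans (sym (ag (last∈ _ rest))) cl , u

chains-agree : ∀ {σ σ' : SE n → SE n} {x} ys → Chain σ x ys → Chain σ' x ys →
               σ (lastOf x ys) ≡ σ' (lastOf x ys) → ∀ {z} → z ∈ x ∷ ys → σ z ≡ σ' z
chains-agree [] _ _ eq (here refl) = eq
chains-agree (y ∷ ys) (e , _) (e' , _) _ (here refl) = trans e (sym e')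
chains-agree (y ∷ ys) (_ , ch) (_ , ch') eq (there m) = chains-agree ys ch ch' eq m

-- Existence of the cycle through a given entry.

lookup-injective : ∀ {A : Set} {xs : List A} → Unique xs → ∀ i j → lookup xs i ≡ lookup xs j → i ≡ j
lookup-injective (_ ∷ _) zero zero _ = refl
lookup-injective (x∉ ∷ _) zero (suc j) eq = contradiction eq (All.lookup x∉ (∈-lookup j))
lookup-injective (x∉ ∷ _) (suc i) zero eq = contradiction (sym eq) (All.lookup x∉ (∈-lookup i))
lookup-injective (_ ∷ u) (suc i) (suc j) eq = cong suc (lookup-injective u i j eq)

-- Pigeonhole: sign and index together encode an entry as one of 2n numbers. The bound makes the
-- tracing of a cycle stop.
signed-length : (xs : List (SE n)) → Unique xs → length xs ≤ 2 ℕ.* n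
signed-length {n} xs u = injective⇒≤ {f = λ i → code (lookup xs i)} (λ eq → lookup-injective u _ _ (code-injective eq))
  where
  bit : Bool → Fin 2
  bit false = zero
  bit true  = suc zero
  code : SE n → Fin (2 ℕ.* n)
  code (b , i) = combine (bit b) i
  bit-injective : ∀ {b b'} → bit b ≡ bit b' → b ≡ b'
  bit-injective {false} {false} _ = refl
  bit-injective {true} {true} _ = refl
  code-injective : ∀ {x y} → code x ≡ code y → x ≡ y
  code-injective {b , i} {b' , i'} eq with e , refl ← combine-injective (bit b) i (bit b') i' eq =
    cong (_, i) (bit-injective e)

module _ {σ : SE n → SE n} (σ-bij : Bijective _≡_ _≡_ σ) where

  private
    σ⁻¹ : SE n → SE n
    σ⁻¹ y = proj₁ (proj₂ σ-bij y)

    σσ⁻¹ : ∀ y → σ (σ⁻¹ y) ≡ y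
    σσ⁻¹ y = proj₂ (proj₂ σ-bij y) refl

    -- `m` is fuel: by the inequality, exhausting it would give more than 2n distinct signed
    -- entries.
    extend : ∀ {c} m x xs → 2 ℕ.* n ℕ.< m ℕ.+ length (c ∷ x ∷ xs) → Chain σ x xs → σ (lastOf x xs) ≡ c →
             Unique (c ∷ x ∷ xs) → ∃ (IsCycle σ c)
    extend zero x xs lt _ _ u = contradiction (signed-length _ u) (ℕₚ.<⇒≱ lt)
    extend {c} (suc m) x xs lt ch eq u@((c≢x ∷ c∉xs) ∷ x∉xs ∷ uxs) with σ⁻¹ x ≟ₛ c
    ... | yes y≡c = x ∷ xs , (trans (cong σ (sym y≡c)) (σσ⁻¹ x) , ch) , eq , u
    ... | no  y≢c = extend m (σ⁻¹ x) (x ∷ xs) (subst (2 ℕ.* n ℕ.<_) (sym (ℕₚ.+-suc m _)) lt) (σσ⁻¹ x , ch) eq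
                      ((y≢c ∘ sym ∷ c≢x ∷ c∉xs) ∷ Allₚ.¬Any⇒All¬ _ y∉ ∷ x∉xs ∷ uxs)
      where
      -- Were the preimage of `x` the last entry, `x` would equal `c`; anywhere else in the list,
      -- its image `x` would recur in `xs`.
      y∉ : σ⁻¹ x ∉ x ∷ xs
      y∉ m with chain-next xs ch m
      ... | inj₁ y≡last = c≢x (trans (sym eq) (trans (cong σ (sym y≡last)) (σσ⁻¹ x)))
      ... | inj₂ σy∈xs = All.lookup x∉xs (subst (_∈ xs) (σσ⁻¹ x) σy∈xs) refl

  -- The cycle is traced backwards from c.
  cycle-of : ∀ c → ∃ (IsCycle σ c)
  cycle-of c with σ⁻¹ c ≟ₛ c
  ... | yes eq = [] , tt , trans (cong σ (sym eq)) (σσ⁻¹ c) , [] ∷ []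
  ... | no neq = extend (2 ℕ.* n) (σ⁻¹ c) [] (ℕₚ.m<m+n _ (s≤s ℕ.z≤n)) tt (σσ⁻¹ c)
                   ((neq ∘ sym ∷ []) ∷ [] ∷ [])

-- Trees that record a permutation.

-- The tree with root path v₁, …, v_d records the cycles starting at v₁, …, v_{d-1}
-- in its left subtrees and the special cycle (v_d , -v_d) in its rightmost leaf.
data Records {n} (σ : SE n → SE n) : Tree n → Set where
  special : ∀ {k} → σ (pos k) ≡ neg (pos k) → Records σ (leaf (just k))
  node    : ∀ {a l r rest} → WordOf l (reverse rest) → IsCycle σ (pos a) rest → Records σ r →
            Records σ (node a l r)

abs-cycle : ∀ {l : Tree n} {rest} → WordOf l (reverse rest) → abs rest ↭ labels l
abs-cycle {rest = rest} wl = ↭-trans (↭-sym (abs-reverse rest)) (abs-wordOf wl)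

records-agree : ∀ {σ σ' : SE n → SE n} {t} → (∀ {x} → ∣ x ∣ₛ ∈ labels t → σ x ≡ σ' x) →
                Records σ t → Records σ' t
records-agree ag (special eq) = special (trans (sym (ag (here refl))) eq)
records-agree {t = node a l r} ag (node wl cyc rr) =
  node wl (cycle-agree (λ z∈ → ag (∈-++⁺ˡ {xs = a ∷ labels l} (∈-resp-↭ (prep a (abs-cycle wl)) (∈-map⁺ ∣_∣ₛ z∈)))) cyc)
       (records-agree (λ x∈ → ag (∈-++⁺ʳ (a ∷ labels l) x∈)) rr)

records-rightmost : ∀ {σ : SE n → SE n} {t} → Records σ t →
                    ∃[ k ] rightmostLeaf t ≡ just k × σ (pos k) ≡ neg (pos k)
records-rightmost (special eq) = _ , refl , eq
records-rightmost (node _ _ rr) = records-rightmost rr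

rightmost∈labels : ∀ {k} (t : Tree n) → rightmostLeaf t ≡ just k → k ∈ labels t
rightmost∈labels (leaf (just _)) refl = here refl
rightmost∈labels (node a l r) eq = ∈-++⁺ʳ (a ∷ labels l) (rightmost∈labels r eq)

++-cancelˡ-↭ : ∀ {A : Set} (xs : List A) {ys zs} → xs ++ ys ↭ xs ++ zs → ys ↭ zs
++-cancelˡ-↭ [] p = p
++-cancelˡ-↭ (x ∷ xs) p = ++-cancelˡ-↭ xs (drop-∷ p)

root-minimum : ∀ {a : Fin n} {xs ys b} → All (a <_) xs → All (a <_) ys → b ∈ a ∷ xs ++ ys → b ≡ a ⊎ a < b
root-minimum ax ay (here eq) = inj₁ eq
root-minimum ax ay (there m) = inj₂ (All.lookup (Allₚ.++⁺ ax ay) m)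

-- Besides its root, a node contains the label of the rightmost leaf of `r`.
¬leaf↭node : ∀ {σ : SE n → SE n} {k a r} xs → Records σ r → ¬ ([ k ] ↭ a ∷ xs ++ labels r)
¬leaf↭node {r = r} xs rr p
  with _ , eq , _ ← records-rightmost rr
  with () ← subst (_ ∈_) (∷-injectiveʳ (↭-singleton-inv (↭-sym p)))
              (∈-++⁺ʳ xs (rightmost∈labels r eq))

-- The root is the smallest label, hence common to both trees. It fixes the cycle, the cycle fixes
-- the left subtree through its word, and the right subtrees keep equal label sets.
records-unique : ∀ {σ : SE n → SE n} {t t'} → Records σ t → Records σ t' → Increasing t → Increasing t' →
                 labels t ↭ labels t' → t ≡ t'
records-unique (special _) (special _) _ _ p with refl ← ↭-singleton-inv p = refl
records-unique (special _) (node {l = l} _ _ rr) _ _ p = ⊥-elim (¬leaf↭node (labels l) rr p)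
records-unique (node {l = l} _ _ rr) (special _) _ _ p = ⊥-elim (¬leaf↭node (labels l) rr (↭-sym p))
records-unique (node {a} wl cyc rr) (node {a'} wl' cyc' rr') (al , ar , il , ir) (al' , ar' , il' , ir') p
  with root-minimum al' ar' (∈-resp-↭ p (here refl)) | root-minimum al ar (∈-resp-↭ (↭-sym p) (here refl))
... | inj₂ a'<a | inj₁ refl = contradiction a'<a (<-irrefl refl)
... | inj₂ a'<a | inj₂ a<a' = contradiction a<a' (<-asym a'<a)
... | inj₁ refl | _
  with refl ← cycle-unique cyc cyc'
  with refl ← wordOf-injective wl wl' refl
  = cong (node a _) (records-unique rr rr' ir ir' (++-cancelˡ-↭ (a ∷ labels _) p))

-- The words of the left subtrees give back one cycle of each pair; compatibility with `neg` gives
-- the opposite one.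
records-determine : ∀ {σ σ' : SE n → SE n} {t} → (∀ x → σ (neg x) ≡ neg (σ x)) → (∀ x → σ' (neg x) ≡ neg (σ' x)) →
                    Records σ t → Records σ' t → ∀ x → ∣ x ∣ₛ ∈ labels t → σ x ≡ σ' x
records-determine sg sg' (special e) (special e') (false , _) (here refl) = trans e (sym e')
records-determine sg sg' (special e) (special e') (true , _) (here refl) =
  trans (sg _) (trans (cong neg (trans e (sym e'))) (sym (sg' _)))
records-determine {σ = σ} {σ'} {node a l r} sg sg' (node {rest = rest} wl cyc rr) (node {rest = rest'} wl' cyc' rr') x m
  with refl ← reverse-injective {x = rest} {rest'} (wordOf-functional wl wl')
  with ∈-++⁻ (a ∷ labels l) m
... | inj₂ mr = records-determine sg sg' rr rr' x mr
... | inj₁ ml with ∈-abs⁻ x (pos a ∷ rest) (∈-resp-↭ (prep a (↭-sym (abs-cycle wl))) ml)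
... | inj₁ x∈ = chains-agree rest (proj₁ cyc) (proj₁ cyc') (trans (proj₁ (proj₂ cyc)) (sym (proj₁ (proj₂ cyc')))) x∈
... | inj₂ -x∈ =
  trans (cong σ (sym (neg-involutive x)))
  (trans (sg (neg x))
  (trans (cong neg (chains-agree rest (proj₁ cyc) (proj₁ cyc') (trans (proj₁ (proj₂ cyc)) (sym (proj₁ (proj₂ cyc')))) -x∈))
  (trans (sym (sg' (neg x))) (cong σ' (neg-involutive x)))))

-- From recording trees to the conditions on the permutation.

record Block {n} (σ : SE n → SE n) (k : Fin n) (x : SE n) : Set where
  field
    {a}    : Fin n
    {rest} : List (SE n)
    cycle    : IsCycle σ (pos a) rest
    minimum  : a ≺* rest
    a<k      : a < k
    snake    : Alt up a (abs rest)
    distinct : Unique (abs (pos a ∷ rest))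
    -- Only one cycle of each pair is recorded, so `x` may lie on its opposite.
    covers   : x ∈ pos a ∷ rest ⊎ neg x ∈ pos a ∷ rest

locate : ∀ {σ : SE n → SE n} {k t} → Records σ t → Increasing t → Unique (labels t) → rightmostLeaf t ≡ just k →
         ∀ x → ∣ x ∣ₛ ∈ labels t → ∣ x ∣ₛ ≡ k ⊎ Block σ k x
locate (special _) _ _ refl x (here eq) = inj₁ eq
locate {t = node a l r} (node {rest = rest} wl cyc rr) (al , ar , il , ir) u@(a∉ ∷ ulr) eq x m
  with ul , ur , dj ← ++-unique⁻ (labels l) ulr
  with ∈-++⁻ (a ∷ labels l) m
... | inj₂ mr = locate rr ir ur eq x mr
... | inj₁ ml = inj₂ record
  { cycle    = cyc
  ; minimum  = a≺rest
  ; a<k      = All.lookup ar (rightmost∈labels r eq)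
  ; snake    = subst (λ w → Alt up a (abs w)) (reverse-involutive rest)
                 (word⇒alt (Allₚ.map⁻ (All-resp-↭ (↭-sym (abs-wordOf wl)) al)) (wordOf-word wl))
  ; distinct = Unique-resp-↭ (prep a (↭-sym (abs-cycle wl))) (Allₚ.++⁻ˡ (labels l) a∉ ∷ ul)
  ; covers   = ∈-abs⁻ x (pos a ∷ rest) (∈-resp-↭ (prep a (↭-sym (abs-cycle wl))) ml)
  }
  where
  a≺rest : a ≺* rest
  a≺rest = Allₚ.map⁻ (All-resp-↭ (↭-sym (abs-cycle wl)) al)

module _ {σ : SE n → SE n} (σ-neg : ∀ x → σ (neg x) ≡ neg (σ x)) where

  closed-neg : ∀ {P} → Closed σ P → Closed σ (P ∘ neg)
  closed-neg {P} cl x p = subst P (σ-neg x) (cl (neg x) p)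

  records⇒CUD : ∀ {k t} → Records σ t → Increasing t → Unique (labels t) → (∀ i → i ∈ labels t) →
                rightmostLeaf t ≡ just k → IsCUD σ k
  records⇒CUD {k} {t} rec inc uniq full eq = σk , only , others
    where
    σk : σ (pos k) ≡ neg (pos k)
    σk with records-rightmost rec
    ... | _ , eq' , h with refl ← trans (sym eq) eq' = h

    find : ∀ x → ∣ x ∣ₛ ≡ k ⊎ Block σ k x
    find x = locate rec inc uniq eq x (full ∣ x ∣ₛ)

    only : ∀ c rest → IsCycle σ c rest → neg c ∈ c ∷ rest → ∣ c ∣ₛ ≡ k
    only c rest cyc@(ch , _) -c∈ with find c
    ... | inj₁ h = h
    -- The cycle through `c` never leaves the block or its negative, and distinct labels keep
    -- opposite entries out of either.
    ... | inj₂ b with Block.covers b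
    ... | inj₁ c∈  = contradiction (chain-forward rest (cycle-closed (Block.cycle b)) ch c∈ -c∈)
                                   (unique-abs⇒neg∉ (Block.distinct b) c∈)
    ... | inj₂ c∈  = contradiction (chain-forward rest (closed-neg (cycle-closed (Block.cycle b))) ch c∈ -c∈)
                                   (unique-abs⇒neg∉ (Block.distinct b) c∈)

    others : ∀ c rest → IsCycle σ c rest → neg c ∉ c ∷ rest → IsPositive c → ∣ c ∣ₛ ≺* rest →
             ∣ c ∣ₛ < k × Alt up ∣ c ∣ₛ (abs rest)
    others c@(_ , i) rest cyc -c∉ refl c≺ with find c
    ... | inj₁ refl = contradiction (subst (_∈ c ∷ rest) σk (cycle-closed cyc _ (here refl))) -c∉
    -- Up to sign, each of the two starts lies on the other's cycle and is smallest on its own, so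
    -- their absolute values agree. Both are positive, so the starts coincide, and with them the
    -- cycles.
    ... | inj₂ b with Block.covers b | cycle-to-start (Block.cycle b) (cycle-closed cyc)
                 | cycle-to-start (Block.cycle b) (closed-neg (cycle-closed cyc))
    ... | inj₁ (here refl) | _ | _ with refl ← cycle-unique cyc (Block.cycle b) = Block.a<k b , Block.snake b
    ... | inj₁ (there c∈) | reach | _ with reach (there c∈) (here refl)
    ...   | here refl = contradiction (All.lookup (Block.minimum b) c∈) (<-irrefl refl)
    ...   | there a∈  = contradiction (All.lookup c≺ a∈) (<-asym (All.lookup (Block.minimum b) c∈))
    others c@(_ , i) rest cyc -c∉ refl c≺ | inj₂ b | inj₂ (there -c∈) | _ | reach
      with there -a∈ ← reach (there -c∈) (here refl) =
      contradiction (All.lookup c≺ -a∈) (<-asym (All.lookup (Block.minimum b) -c∈))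

-- From a permutation to its tree.

_∈?ₗ_ : (i : Fin n) (xs : List (Fin n)) → Dec (i ∈ xs)
_∈?ₗ_ = DecMembership._∈?_ Finₚ._≟_

remove : List (Fin n) → List (Fin n) → List (Fin n)
remove xs = filter (λ i → ¬? (i ∈?ₗ xs))

∈-remove⁻ : ∀ xs ys {i : Fin n} → i ∈ remove xs ys → i ∈ ys × i ∉ xs
∈-remove⁻ xs ys = ∈-filter⁻ (λ i → ¬? (i ∈?ₗ xs)) {xs = ys}

∈-remove⁺ : ∀ xs {ys} {i : Fin n} → i ∈ ys → i ∉ xs → i ∈ remove xs ys
∈-remove⁺ xs = ∈-filter⁺ (λ i → ¬? (i ∈?ₗ xs))

remove-↭ : ∀ {xs ys : List (Fin n)} → Unique xs → Unique ys → (∀ {i} → i ∈ xs → i ∈ ys) →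
           xs ++ remove xs ys ↭ ys
remove-↭ {xs = xs} {ys} ux uy xs⊆ys = ∼bag⇒↭ (unique∧set⇒bag
  (Uniqueₚ.++⁺ ux (Uniqueₚ.filter⁺ _ uy) (λ (i , j) → proj₂ (∈-remove⁻ xs ys j) i)) uy (mk⇔ to from))
  where
  to : ∀ {i} → i ∈ xs ++ remove xs ys → i ∈ ys
  to m with ∈-++⁻ xs m
  ... | inj₁ h = xs⊆ys h
  ... | inj₂ h = proj₁ (∈-remove⁻ xs ys h)
  from : ∀ {i} → i ∈ ys → i ∈ xs ++ remove xs ys
  from {i} m with i ∈?ₗ xs
  ... | yes h = ∈-++⁺ˡ h
  ... | no  h = ∈-++⁺ʳ xs (∈-remove⁺ xs m h)

module FromPermutation {σ : SE n → SE n} {k : Fin n} (signed : IsSignedPerm σ) (cud : IsCUD σ k) where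

  private
    σ-neg  = proj₁ signed
    σ-bij  = proj₂ signed
    σk     = proj₁ cud
    only   = proj₁ (proj₂ cud)
    others = proj₂ (proj₂ cud)

  σ-k : ∀ x → ∣ x ∣ₛ ≡ k → σ x ≡ neg x
  σ-k (false , _) refl = σk
  σ-k (true , _) refl = trans (σ-neg (pos k)) (cong neg σk)

  absolute-k : Closed σ (λ x → ∣ x ∣ₛ ≡ k)
  absolute-k x eq = trans (cong ∣_∣ₛ (σ-k x eq)) eq

  -- Here `σ (σ x)` is `neg (σ x)`, that is `σ (neg x)`, so injectivity gives `σ x ≡ neg x`.
  σ-k⁻ : ∀ x → ∣ σ x ∣ₛ ≡ k → ∣ x ∣ₛ ≡ k
  σ-k⁻ x eq = trans (cong ∣_∣ₛ (sym (proj₁ σ-bij (trans (σ-k (σ x) eq) (sym (σ-neg x)))))) eq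

  module _ {c : SE n} {rest : List (SE n)} (cyc : IsCycle σ c rest) (c≢k : ∣ c ∣ₛ ≢ k) where

    -- A cycle through two opposite entries also contains the opposite of its start, which `only`
    -- allows for the label `k` alone.
    no-neg : ∀ {y} → y ∈ c ∷ rest → neg y ∉ c ∷ rest
    no-neg y∈ -y∈ = c≢k (only c rest cyc (cycle-to-start cyc (closed-neg σ-neg (cycle-closed cyc)) y∈ -y∈))

    cycle-distinct : Unique (abs (c ∷ rest))
    cycle-distinct = neg∉⇒unique-abs (c ∷ rest) (proj₂ (proj₂ cyc)) no-neg

    k∉cycle : k ∉ abs (c ∷ rest)
    k∉cycle m with y , y∈ , eq ← ∈-map⁻ ∣_∣ₛ m = c≢k (cycle-to-start cyc absolute-k y∈ (sym eq))

    cycle-backward : ∀ x → ∣ σ x ∣ₛ ∈ abs (c ∷ rest) → ∣ x ∣ₛ ∈ abs (c ∷ rest)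
    cycle-backward x m with ∈-abs⁻ (σ x) (c ∷ rest) m
    ... | inj₁ h with y , y∈ , eq ← cycle-previous cyc h with refl ← proj₁ σ-bij eq = ∈-map⁺ ∣_∣ₛ y∈
    ... | inj₂ h with y , y∈ , eq ← cycle-previous cyc h
                 with refl ← proj₁ σ-bij {y} {neg x} (trans eq (sym (σ-neg x))) = ∈-map⁺ ∣_∣ₛ y∈

    -- The cycle stays inside the closed label set, and the least label of that set occurs on it
    -- only at the start.
    above-minimum : ∀ {L} → All (∣ c ∣ₛ <_) L → (∀ x → ∣ x ∣ₛ ∈ ∣ c ∣ₛ ∷ L → ∣ σ x ∣ₛ ∈ ∣ c ∣ₛ ∷ L) → ∣ c ∣ₛ ≺* rest
    above-minimum {L} c< closed = All.tabulate λ {y} y∈ →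
      above (∈-map⁺ ∣_∣ₛ y∈) (chain-forward {P = λ x → ∣ x ∣ₛ ∈ ∣ c ∣ₛ ∷ L} rest closed (proj₁ cyc) (here refl) (there y∈))
      where
      above : ∀ {i} → i ∈ abs rest → i ∈ ∣ c ∣ₛ ∷ L → ∣ c ∣ₛ < i
      above m (there h) = All.lookup c< h
      above m (here refl) with c∉ ∷ _ ← cycle-distinct = contradiction refl (All.lookup c∉ m)

    -- By `cycle-backward`, an entry whose label is off the cycle is never mapped to a label on it.
    removal-closed : ∀ {L} → All (∣ c ∣ₛ <_) L → (∀ x → ∣ x ∣ₛ ∈ ∣ c ∣ₛ ∷ L → ∣ σ x ∣ₛ ∈ ∣ c ∣ₛ ∷ L) →
                     ∀ x → ∣ x ∣ₛ ∈ remove (abs rest) L → ∣ σ x ∣ₛ ∈ remove (abs rest) L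
    removal-closed {L} c< closed x x∈ with x∈L , x∉ ← ∈-remove⁻ (abs rest) L x∈ = stay (closed x (there x∈L))
      where
      σx∉ : ∣ σ x ∣ₛ ∉ abs (c ∷ rest)
      σx∉ m with cycle-backward x m
      ... | here eq = <-irrefl (sym eq) (All.lookup c< x∈L)
      ... | there h = x∉ h
      stay : ∣ σ x ∣ₛ ∈ ∣ c ∣ₛ ∷ L → ∣ σ x ∣ₛ ∈ remove (abs rest) L
      stay (here eq) = contradiction (here eq) σx∉
      stay (there h) = ∈-remove⁺ (abs rest) h (σx∉ ∘ there)

  -- `L` lists in increasing order the labels not yet placed. Its least label is the next one on the
  -- rightmost path; the labels of its cycle are then removed. The path ends when this label is `k`.
  build : ∀ m L → length L ≤ m → AllPairs _<_ L → (∀ x → ∣ x ∣ₛ ∈ L → ∣ σ x ∣ₛ ∈ L) → k ∈ L →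
          ∃[ t ] labels t ↭ L × Increasing t × rightmostLeaf t ≡ just k × Records σ t
  build (suc m) (a ∷ L) (s≤s |L|≤m) sorted@(a< ∷ sortedL) closed k∈ with a Finₚ.≟ k
  build (suc m) (a ∷ []) _ _ closed k∈ | yes refl = leaf (just k) , ↭-refl , tt , refl , special σk
  build (suc m) (a ∷ b ∷ L) _ ((a<b ∷ a<) ∷ b< ∷ _) closed k∈ | yes refl
    with rest , cyc ← cycle-of σ-bij (pos b) =
    -- The least label `b` left after `k` would start an ordinary cycle, and such a start must be
    -- below `k`.
    contradiction (proj₁ (others (pos b) rest cyc (no-neg cyc b≢k (here refl)) refl
                            (above-minimum cyc b≢k b< closed'))) (<-asym a<b)
    where
    b≢k : b ≢ k
    b≢k refl = <-irrefl refl a<b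
    closed' : ∀ x → ∣ x ∣ₛ ∈ b ∷ L → ∣ σ x ∣ₛ ∈ b ∷ L
    closed' x x∈ with closed x (there x∈)
    ... | there h = h
    ... | here eq = contradiction (σ-k⁻ x eq) λ { refl → <-irrefl refl (All.lookup (a<b ∷ a<) x∈) }
  build (suc m) (a ∷ L) (s≤s |L|≤m) (a< ∷ sorted) closed k∈ | no a≢k
    with rest , cyc ← cycle-of σ-bij (pos a)
    with a≺ ← above-minimum cyc a≢k a< closed
    with a∉ ∷ ur ← cycle-distinct cyc a≢k
    with _ , alt ← others (pos a) rest cyc (no-neg cyc a≢k (here refl)) refl a≺
    with l , wl ← wordOf-surjective _ ℕₚ.≤-refl (alt⇒word rest alt) (Unique-resp-↭ (↭-sym (abs-reverse rest)) ur)
    with r , r↭ , ir , rk , rr ← build m (remove (abs rest) L)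
           (ℕₚ.≤-trans (length-filter _ L) |L|≤m) (AllPairsₚ.filter⁺ _ sorted)
           (removal-closed cyc a≢k a< closed)
           (∈-remove⁺ (abs rest) (tail (a≢k ∘ sym) k∈) (k∉cycle cyc a≢k ∘ there))
    = node a l r
    , prep a (↭-trans (↭-++⁺ (↭-sym (abs-cycle wl)) r↭)
                      (remove-↭ ur (AllPairs.map (λ i<j i≡j → <-irrefl i≡j i<j) sorted) (rest⊆L cyc a≺)))
    , (All-resp-↭ (abs-cycle wl) (Allₚ.map⁺ a≺) , All-resp-↭ (↭-sym r↭) (Allₚ.filter⁺ _ a<) ,
       wordOf-increasing wl , ir)
    , rk , node wl cyc rr
    where
    rest⊆L : ∀ {rest} → IsCycle σ (pos a) rest → a ≺* rest → ∀ {i} → i ∈ abs rest → i ∈ L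
    rest⊆L {rest} cyc a≺ m with y , y∈ , refl ← ∈-map⁻ ∣_∣ₛ m
      with chain-forward {P = λ x → ∣ x ∣ₛ ∈ a ∷ L} rest closed (proj₁ cyc) (here refl) (there y∈)
    ... | there h = h
    ... | here refl = contradiction (All.lookup a≺ y∈) (<-irrefl refl)

-- Signed permutations with prescribed cycles.

xor-cancelʳ : ∀ b e → (b xor e) xor e ≡ b
xor-cancelʳ false false = refl
xor-cancelʳ false true = refl
xor-cancelʳ true false = refl
xor-cancelʳ true true = refl

xor-cancelˡ : ∀ b e → b xor (b xor e) ≡ e
xor-cancelˡ false _ = refl
xor-cancelˡ true e = not-involutive e

not-xor : ∀ b e → not b xor e ≡ not (b xor e)
not-xor false _ = refl
not-xor true e = sym (not-involutive e)

-- For i ≡ j this multiplies the entries ±i by the sign e.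
transpose : Bool → Fin n → Fin n → SE n → SE n
transpose e i j (b , m) with m Finₚ.≟ i | m Finₚ.≟ j
... | yes _ | _     = b xor e , j
... | no _  | yes _ = b xor e , i
... | no _  | no _  = b , m

module _ (e : Bool) (i j : Fin n) where

  transposeˡ : ∀ b → transpose e i j (b , i) ≡ (b xor e , j)
  transposeˡ b with i Finₚ.≟ i
  ... | yes _  = refl
  ... | no i≢i = contradiction refl i≢i

  transposeʳ : ∀ b → transpose e i j (b , j) ≡ (b xor e , i)
  transposeʳ b with j Finₚ.≟ i | j Finₚ.≟ j
  ... | yes refl | _     = refl
  ... | no _ | yes _  = refl
  ... | no _ | no j≢j = contradiction refl j≢j

  transpose-fixes : ∀ x → ∣ x ∣ₛ ≢ i → ∣ x ∣ₛ ≢ j → transpose e i j x ≡ x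
  transpose-fixes (b , m) m≢i m≢j with m Finₚ.≟ i | m Finₚ.≟ j
  ... | yes m≡i | _       = contradiction m≡i m≢i
  ... | no _    | yes m≡j = contradiction m≡j m≢j
  ... | no _    | no _    = refl

  transpose-neg : ∀ x → transpose e i j (neg x) ≡ neg (transpose e i j x)
  transpose-neg (b , m) with m Finₚ.≟ i | m Finₚ.≟ j
  ... | yes _ | _     = cong (_, j) (not-xor b e)
  ... | no _  | yes _ = cong (_, i) (not-xor b e)
  ... | no _  | no _  = refl

  transpose-involutive : ∀ x → transpose e i j (transpose e i j x) ≡ x
  transpose-involutive (b , m) with m Finₚ.≟ i | m Finₚ.≟ j
  ... | yes refl | _        = trans (transposeʳ (b xor e)) (cong (_, m) (xor-cancelʳ b e))
  ... | no _     | yes refl = trans (transposeˡ (b xor e)) (cong (_, m) (xor-cancelʳ b e))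
  ... | no m≢i   | no m≢j   = transpose-fixes (b , m) m≢i m≢j

  transpose-signed : IsSignedPerm (transpose e i j)
  transpose-signed = transpose-neg ,
    (λ {x} {y} eq → trans (sym (transpose-involutive x)) (trans (cong (transpose e i j) eq) (transpose-involutive y))) ,
    λ y → transpose e i j y , λ { refl → transpose-involutive y }

∘-signed : ∀ {σ τ : SE n → SE n} → IsSignedPerm σ → IsSignedPerm τ → IsSignedPerm (σ ∘ τ)
∘-signed {σ = σ} (σ-neg , σ-bij) (τ-neg , τ-bij) =
  (λ x → trans (cong σ (τ-neg x)) (σ-neg _)) , Composition.bijective _≡_ _≡_ _≡_ τ-bij σ-bij

-- The cycle starting `c`, `d` is the cycle starting at `d` followed by a transposition of `c` and
-- `d`: `c` is sent to `d`, and the last entry, formerly sent to `d`, to `c`. The sign `s xor t`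
-- makes `swap` exchange `c` with `d` itself and not with its opposite.
cyclic-permutation : (c : SE n) (rest : List (SE n)) → Unique (abs (c ∷ rest)) →
  ∃[ γ ] IsSignedPerm γ × IsCycle γ c rest × (∀ x → ∣ x ∣ₛ ∉ abs (c ∷ rest) → γ x ≡ x)
cyclic-permutation c [] _ =
  id , ((λ _ → refl) , Identity.bijective _≡_) , (tt , refl , [] ∷ []) , λ _ _ → refl
cyclic-permutation c@(s , i) (d@(t , j) ∷ ds) u@(c∉@(i≢j ∷ i∉) ∷ ud@(j∉ ∷ _))
  with τ , τ-signed , (ch , close , _) , τ-fixes ← cyclic-permutation d ds ud =
  swap ∘ τ , ∘-signed {τ = τ} (transpose-signed _ i j) τ-signed ,
  ( ( trans (cong swap (τ-fixes c λ m → All.lookup c∉ m refl)) (trans (transposeˡ _ i j s) (cong (_, j) (xor-cancelˡ s t)))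
    , chain-fixed ds (λ m → transpose-fixes _ i j _
        (λ eq → All.lookup i∉ (∈-map⁺ ∣_∣ₛ m) (sym eq)) (λ eq → All.lookup j∉ (∈-map⁺ ∣_∣ₛ m) (sym eq))) ch )
  , trans (cong swap close) (trans (transposeʳ _ i j t) (cong (_, i) swap-sign))
  , Uniqueₚ.map⁻ u ) ,
  λ x x∉ → trans (cong swap (τ-fixes x (x∉ ∘ there)))
             (transpose-fixes _ i j x (x∉ ∘ here) (x∉ ∘ there ∘ here))
  where
  swap = transpose (s xor t) i j
  swap-sign : t xor (s xor t) ≡ s
  swap-sign = trans (xor-comm t (s xor t)) (xor-cancelʳ s t)
  chain-fixed : ∀ {σ ρ : SE _ → SE _} {x} ys → (∀ {y} → y ∈ ys → ρ y ≡ y) → Chain σ x ys → Chain (ρ ∘ σ) x ys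
  chain-fixed [] _ _ = tt
  chain-fixed {ρ = ρ} (y ∷ ys) fix (eq , ch) = trans (cong ρ eq) (fix (here refl)) , chain-fixed ys (fix ∘ there) ch

-- The cyclic permutations have disjoint supports, so each acts alone on its own labels. That labels
-- outside the tree are fixed is the invariant which ensures this.
realize : ∀ {k} (t : Tree n) → Increasing t → Unique (labels t) → rightmostLeaf t ≡ just k →
          ∃[ σ ] IsSignedPerm σ × Records σ t × (∀ x → ∣ x ∣ₛ ∉ labels t → σ x ≡ x)
realize (leaf (just k)) _ _ refl =
  transpose true k k , transpose-signed true k k , special (transposeˡ true k k false) ,
  λ x x∉ → transpose-fixes true k k x (x∉ ∘ here) (x∉ ∘ here)
realize (node a l r) (al , ar , il , ir) (a∉ ∷ ulr) eq
  with ul , ur , dj ← ++-unique⁻ (labels l) ulr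
  with w , wl' ← wordOf-total l il ul
  with rest ← reverse w | wl ← subst (WordOf l) (sym (reverse-involutive w)) wl'
  with γ , γ-signed , γ-cycle , γ-fixes ← cyclic-permutation (pos a) rest
         (Unique-resp-↭ (prep a (↭-sym (abs-cycle wl))) (Allₚ.++⁻ˡ (labels l) a∉ ∷ ul))
  with ρ , ρ-signed , ρ-records , ρ-fixes ← realize r ir ur eq
  = ρ ∘ γ , ∘-signed ρ-signed γ-signed ,
    node wl (cycle-agree (λ z∈ → sym (ρ-fixes _ (λ z∈r → disjoint (in-block wl (∈-map⁺ ∣_∣ₛ (cycle-closed γ-cycle _ z∈))) z∈r))) γ-cycle)
      (records-agree (λ x∈r → cong ρ (sym (γ-fixes _ λ x∈ → disjoint (in-block wl x∈) x∈r))) ρ-records) ,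
    λ x x∉ → trans (cong ρ (γ-fixes x (x∉ ∘ ∈-++⁺ˡ ∘ in-block wl))) (ρ-fixes x (x∉ ∘ ∈-++⁺ʳ (a ∷ labels l)))
  where
  in-block : ∀ {rest i} → WordOf l (reverse rest) → i ∈ a ∷ abs rest → i ∈ a ∷ labels l
  in-block wl = ∈-resp-↭ (prep a (abs-cycle wl))
  disjoint : ∀ {i} → i ∈ a ∷ labels l → i ∉ labels r
  disjoint = proj₂ (proj₂ (++-unique⁻ (a ∷ labels l) (a∉ ∷ ulr)))

-- The bijection and its effect on the rightmost label.

special-unique : ∀ {σ : SE n → SE n} {j k} → (∀ x → σ (neg x) ≡ neg (σ x)) → IsCUD σ j → IsCUD σ k → j ≡ k
special-unique {j = j} σ-neg (σj , _) (_ , only , _) =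
  only (pos j) [ neg (pos j) ] ((σj , tt) , trans (σ-neg (pos j)) (cong neg σj) , ((λ ()) ∷ []) ∷ [] ∷ []) (there (here refl))

record TreeFor {n} (σ : SE n → SE n) (k : Fin n) : Set where
  field
    tree      : Tree n
    isT       : IsT tree
    rightmost : rightmostLeaf tree ≡ just k
    records   : Records σ tree

treeFor : ∀ {σ : SE n → SE n} {k} → IsSignedPerm σ → IsCUD σ k → TreeFor σ k
treeFor {n} signed cud
  with t , t↭ , inc , eq , rec ← FromPermutation.build signed cud _ (allFin n) ℕₚ.≤-refl
         (AllPairsₚ.tabulate⁺-< id) (λ _ _ → ∈-allFin _) (∈-allFin _)
  = record { tree = t ; isT = t↭ , inc ; rightmost = eq ; records = rec }

∈-labels : ∀ {t : Tree n} → IsT t → ∀ i → i ∈ labels t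
∈-labels (t↭ , _) i = ∈-resp-↭ (↭-sym t↭) (∈-allFin i)

open TreeFor

theorem5p3 : (n : ℕ) → 1 ≤ n →
    Σ (Bijection (CUD-setoid n) (Tstar-setoid n)) λ φ →
    (k : Fin n) (σ : CUD n) →
    IsCUD (proj₁ (proj₁ σ)) k ⇔ (rightmostLeaf (proj₁ (Bijection.to φ σ)) ≡ just k)
theorem5p3 n _ = φ , rightmost-label
  where
  tree-of : (σ : CUD n) → TreeFor (proj₁ (proj₁ σ)) (proj₁ (proj₂ σ))
  tree-of ((_ , signed) , _ , cud) = treeFor signed cud

  -- Any recording tree is the constructed one, which yields both independence of the representative
  -- and surjectivity.
  tree-of-unique : (σ : CUD n) {t : Tree n} → IsT t → Records (proj₁ (proj₁ σ)) t → tree (tree-of σ) ≡ t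
  tree-of-unique σ (t↭ , inc) rec = records-unique (records (tree-of σ)) rec (proj₂ (isT (tree-of σ))) inc
    (↭-trans (proj₁ (isT (tree-of σ))) (↭-sym t↭))

  to : CUD n → Tstar n
  to σ = tree (tree-of σ) , isT (tree-of σ) , _ , rightmost (tree-of σ)

  to-cong : ∀ {σ τ} → (∀ x → proj₁ (proj₁ σ) x ≡ proj₁ (proj₁ τ) x) → proj₁ (to σ) ≡ proj₁ (to τ)
  to-cong {σ} {τ} σ≗τ = tree-of-unique σ (isT (tree-of τ))
    (records-agree (λ {x} _ → sym (σ≗τ x)) (records (tree-of τ)))

  to-injective : ∀ {σ τ} → proj₁ (to σ) ≡ proj₁ (to τ) → ∀ x → proj₁ (proj₁ σ) x ≡ proj₁ (proj₁ τ) x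
  to-injective {σ@((_ , σ-neg , _) , _)} {τ@((f , τ-neg , _) , _)} eq x =
    records-determine σ-neg τ-neg (records (tree-of σ)) (subst (Records f) (sym eq) (records (tree-of τ))) x
      (∈-labels (isT (tree-of σ)) ∣ x ∣ₛ)

  to-surjective : ∀ t → ∃[ σ ] (∀ {τ} → (∀ x → proj₁ (proj₁ τ) x ≡ proj₁ (proj₁ σ) x) → proj₁ (to τ) ≡ proj₁ t)
  to-surjective (t , isT@(t↭ , inc) , k , eq)
    with uniq ← Unique-resp-↭ (↭-sym t↭) (Uniqueₚ.allFin⁺ n)
    with σ , signed , rec , _ ← realize t inc uniq eq
    = ((σ , signed) , k , records⇒CUD (proj₁ signed) rec inc uniq (∈-labels isT) eq) ,
      λ {τ} τ≗σ → tree-of-unique τ isT (records-agree (λ {x} _ → sym (τ≗σ x)) rec)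

  φ : Bijection (CUD-setoid n) (Tstar-setoid n)
  φ = record
    { to        = to
    ; cong      = λ {σ} {τ} → to-cong {σ} {τ}
    ; bijective = (λ {σ} {τ} → to-injective {σ} {τ}) , to-surjective
    }

  rightmost-label : ∀ k σ → IsCUD (proj₁ (proj₁ σ)) k ⇔ (rightmostLeaf (proj₁ (to σ)) ≡ just k)
  rightmost-label k σ@((f , σ-neg , _) , j , cud) = mk⇔
    (λ cud' → trans (rightmost (tree-of σ)) (cong just (special-unique σ-neg cud cud')))
    (λ eq → subst (IsCUD f) (just-injective (trans (sym (rightmost (tree-of σ))) eq)) cud)
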